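{- Consider the variety of abelian groups and presentations with a single generator $a$ and a single relator $w(a)=\sum_{i=1}^{m} d_i a$, $d_i=\pm1$, and let $X=\sum_{i=1}^m d_i$. For every odd prime $p$ and every integer $n\ge 0$, the property $p^{n+1}\mid X$ has limiting density $\frac{1}{p^{n+1}}$.
   Context: A relator of length $m$ is a formal sum $d_1a+\cdots+d_ma$ with each $d_i\in\{1,-1\}$ (so there are $2^m$ relators of length $m$; the relator of length $0$ is the empty sum). $X$ is the difference between the number of occurrences of $a$ and the number of occurrences of its inverse in the relator. Let $P_s$ be the number of relators of length at most $s$, and for a property $Q$ of relators let $P_s(Q)$ be the number of relators of length at most $s$ with property $Q$. The limiting density of $Q$ is $\lim_{s\to\infty}P_s(Q)/P_s$, if this limit exists. -}

module Defs where

open import Data.Integer.Base as ℤ using (ℤ; 0ℤ; _◃_)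
open import Data.List.Base using (List; []; _∷_; [_]; _++_; cartesianProductWith; filter; foldr; length; map)
open import Data.List.Membership.Propositional using (_∈_)
open import Data.List.Membership.Propositional.Properties
  using (∈-++⁺ˡ; ∈-++⁺ʳ; ∈-++⁻; ∈-cartesianProductWith⁺; ∈-cartesianProductWith⁻; ∈-length)
open import Data.List.Properties using (∷-injective)
open import Data.List.Relation.Unary.All using ([]; _∷_)
open import Data.List.Relation.Unary.AllPairs using ([]; _∷_)
open import Data.List.Relation.Unary.Any using (here; there)
open import Data.List.Relation.Unary.Unique.Propositional using (Unique)
open import Data.List.Relation.Unary.Unique.Propositional.Properties using (cartesianProductWith⁺; ++⁺)
open import Data.Nat.Base using (ℕ; zero; suc; _≤_; z≤n; NonZero; >-nonZero)
open import Data.Nat.Properties using (≤-reflexive; m≤n⇒m<n∨m≡n; m≤n⇒m≤1+n; ≤-pred; n≤0⇒n≡0; 1+n≰n)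
open import Data.Product.Base using (_,_; ∃-syntax)
open import Data.Rational.Base as ℚ using (ℚ; 0ℚ; _/_; ∣_∣)
open import Data.Sign.Base using (Sign)
open import Data.Sum.Base using (inj₁; inj₂)
open import Function.Bundles using (_⇔_; mk⇔)
open import Level using (0ℓ)
open import Relation.Binary.PropositionalEquality using (_≡_; refl; cong; subst; sym)
open import Relation.Unary using (Pred; Decidable)

-- The formal sum d₁a + ⋯ + dₘa in one generator a is recorded by its
-- coefficient list d₁ ∷ ⋯ ∷ dₘ ∷ [].  No cancellation is performed, so
-- there are 2ᵐ relators of length m.
Relator : Set
Relator = List Sign

X : Relator → ℤ
X w = foldr ℤ._+_ 0ℤ (map (_◃ 1) w)

relatorsOfLength : ℕ → List Relator
relatorsOfLength zero    = [ [] ]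
relatorsOfLength (suc m) =
  cartesianProductWith _∷_ (Sign.+ ∷ Sign.- ∷ []) (relatorsOfLength m)

relatorsUpTo : ℕ → List Relator
relatorsUpTo zero    = relatorsOfLength zero
relatorsUpTo (suc s) = relatorsUpTo s ++ relatorsOfLength (suc s)

P : ℕ → ℕ
P s = length (relatorsUpTo s)

P[_] : {Q : Pred Relator 0ℓ} → Decidable Q → ℕ → ℕ
P[ Q? ] s = length (filter Q? (relatorsUpTo s))

-- relatorsUpTo s lists every relator of length at most s exactly once
-- (∈-relatorsUpTo and relatorsUpTo-unique), so P and P[_] are the
-- intended cardinalities.

∈-relatorsOfLength⁺ : ∀ w → w ∈ relatorsOfLength (length w)
∈-relatorsOfLength⁺ []      = here refl
∈-relatorsOfLength⁺ (d ∷ w) =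
  ∈-cartesianProductWith⁺ _∷_ (∈-signs d) (∈-relatorsOfLength⁺ w)
  where
  ∈-signs : ∀ e → e ∈ Sign.+ ∷ Sign.- ∷ []
  ∈-signs Sign.+ = here refl
  ∈-signs Sign.- = there (here refl)

∈-relatorsOfLength⁻ : ∀ m {w} → w ∈ relatorsOfLength m → length w ≡ m
∈-relatorsOfLength⁻ zero    (here refl) = refl
∈-relatorsOfLength⁻ (suc m) w∈
  with _ , _ , _ , v∈ , refl ← ∈-cartesianProductWith⁻ _∷_ (Sign.+ ∷ Sign.- ∷ []) (relatorsOfLength m) w∈
  = cong suc (∈-relatorsOfLength⁻ m v∈)

∈-relatorsUpTo⁺ : ∀ s w → length w ≤ s → w ∈ relatorsUpTo s
∈-relatorsUpTo⁺ zero    w l≤0 =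
  subst (λ l → w ∈ relatorsOfLength l) (n≤0⇒n≡0 l≤0) (∈-relatorsOfLength⁺ w)
∈-relatorsUpTo⁺ (suc s) w l≤1+s with m≤n⇒m<n∨m≡n l≤1+s
... | inj₁ l<1+s = ∈-++⁺ˡ (∈-relatorsUpTo⁺ s w (≤-pred l<1+s))
... | inj₂ l≡1+s = ∈-++⁺ʳ (relatorsUpTo s)
  (subst (λ l → w ∈ relatorsOfLength l) l≡1+s (∈-relatorsOfLength⁺ w))

∈-relatorsUpTo⁻ : ∀ s {w} → w ∈ relatorsUpTo s → length w ≤ s
∈-relatorsUpTo⁻ zero    w∈ = ≤-reflexive (∈-relatorsOfLength⁻ zero w∈)
∈-relatorsUpTo⁻ (suc s) w∈ with ∈-++⁻ (relatorsUpTo s) w∈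
... | inj₁ w∈ˡ = m≤n⇒m≤1+n (∈-relatorsUpTo⁻ s w∈ˡ)
... | inj₂ w∈ʳ = ≤-reflexive (∈-relatorsOfLength⁻ (suc s) w∈ʳ)

∈-relatorsUpTo : ∀ s w → w ∈ relatorsUpTo s ⇔ length w ≤ s
∈-relatorsUpTo s w = mk⇔ (∈-relatorsUpTo⁻ s) (∈-relatorsUpTo⁺ s w)

relatorsOfLength-unique : ∀ m → Unique (relatorsOfLength m)
relatorsOfLength-unique zero    = [] ∷ []
relatorsOfLength-unique (suc m) =
  cartesianProductWith⁺ _∷_ ∷-injective
    (((λ ()) ∷ []) ∷ ([] ∷ [])) (relatorsOfLength-unique m)

relatorsUpTo-unique : ∀ s → Unique (relatorsUpTo s)
relatorsUpTo-unique zero    = relatorsOfLength-unique zero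
relatorsUpTo-unique (suc s) =
  ++⁺ (relatorsUpTo-unique s) (relatorsOfLength-unique (suc s))
    λ (w∈ˡ , w∈ʳ) → 1+n≰n (subst (_≤ s) (∈-relatorsOfLength⁻ (suc s) w∈ʳ) (∈-relatorsUpTo⁻ s w∈ˡ))

P-nonZero : ∀ s → NonZero (P s)
P-nonZero s = >-nonZero (∈-length (∈-relatorsUpTo⁺ s [] z≤n))

-- For a rational sequence and a rational limit, rational ε suffice.
_⟶_ : (ℕ → ℚ) → ℚ → Set
f ⟶ L = ∀ ε → 0ℚ ℚ.< ε → ∃[ N ] ∀ s → N ≤ s → ∣ f s ℚ.- L ∣ ℚ.< ε

HasLimitingDensity : (Q : Pred Relator 0ℓ) → Decidable Q → ℚ → Set
HasLimitingDensity Q Q? L = (λ s → (ℤ.+ P[ Q? ] s / P s) {{P-nonZero s}}) ⟶ L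

{-# OPTIONS --safe #-}
-- Let q = p^(n+1), which is odd, and let N m c be the number of relators w of
-- length m with q ∣ X w + c.  Splitting off the first letter gives
-- N (m+1) c = N m (c−1) + N m (c+1), and the error q N m c − 2^m satisfies the
-- same recursion.  Put L = q−1.  As 2 is invertible modulo q, the q points
-- c−L, c−L+2, …, c+L meet every residue class once, so the error sums to 0 over
-- them.  Each of them is reached from c by at least one of the 2^L choices of L
-- signs; removing one choice for each point does not change the value, so the
-- error grows by a factor of at most 2^L − 1 while 2^m grows by 2^L.
-- The density over all lengths ≤ s then follows by a Stolz–Cesàro argument.
module Submission where

open import Defs
open import Algebra.Bundles using (AbelianGroup)
import Algebra.Properties.Group as Group
open import Data.Bool.Base using (true; false)
open import Data.Integer.Base as ℤ using (ℤ; +_; ∣_∣; 0ℤ; 1ℤ; +[1+_]; -[1+_]; +<+)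
open import Data.Integer.Divisibility using (_∣_)
import Data.Integer.Divisibility.Signed as Signed
import Data.Integer.Properties as ℤ
import Data.Integer.Tactic.RingSolver as ℤ-Solver
open import Data.List.Base using ([]; _∷_; _++_; filter; length; map)
open import Data.List.Properties using (++-identityʳ; filter-++; length-++; length-filter; length-map; map-id)
open import Data.Nat.Base as ℕ
  using (ℕ; zero; suc; _+_; _*_; _∸_; _^_; _≤_; _<_; z≤n; s≤s; NonZero)
open import Data.Nat.Divisibility as ℕ using (_∣?_)
import Data.Nat.DivMod as ℕ
open import Data.Nat.Primality using (Prime; prime⇒nonZero)
open import Data.Nat.Properties
open import Data.Nat.Tactic.RingSolver using (solve-∀)
open import Data.Product.Base using (_,_; ∃-syntax)
open import Data.Rational.Base as ℚ using (mkℚ; 0ℚ; toℚᵘ; ↧ₙ_; _/_)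
import Data.Rational.Properties as ℚ
open import Data.Rational.Unnormalised.Base as ℚᵘ using (mkℚᵘ)
import Data.Rational.Unnormalised.Properties as ℚᵘ
open import Data.Sign.Base using (Sign)
open import Function.Base using (_∘_; id)
open import Level using (0ℓ)
open import Relation.Binary.PropositionalEquality
open import Relation.Nullary using (¬_; does; yes; no; contradiction)
open import Relation.Nullary.Decidable using (dec-true; dec-false)
open import Relation.Unary using (Pred; Decidable)

-- The walk operator and sums along progressions of difference 2.

-- The transfer operator of the simple random walk on ℤ without the factor 1/2; one more letter in a
-- relator acts by it.
step : (ℤ → ℤ) → ℤ → ℤ
step f c = f (c ℤ.- 1ℤ) ℤ.+ f (c ℤ.+ 1ℤ)

steps : ℕ → (ℤ → ℤ) → ℤ → ℤ
steps zero    f = f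
steps (suc m) f = step (steps m f)

steps-+ : ∀ m n f → steps (m + n) f ≡ steps m (steps n f)
steps-+ zero    n f = refl
steps-+ (suc m) n f = cong step (steps-+ m n f)

-- The difference is 2 because walks of one fixed length from `c` end at points of one parity.
sumBy2 : ℕ → (ℤ → ℤ) → ℤ → ℤ
sumBy2 zero    f c = 0ℤ
sumBy2 (suc n) f c = f c ℤ.+ sumBy2 n f (c ℤ.+ + 2)

sumBy2-step : ∀ n f c →
  sumBy2 n (step f) c ≡ sumBy2 n f (c ℤ.- 1ℤ) ℤ.+ sumBy2 n f (c ℤ.+ 1ℤ)
sumBy2-step zero    f c = refl
sumBy2-step (suc n) f c = begin
  step f c ℤ.+ sumBy2 n (step f) (c ℤ.+ + 2)
    ≡⟨ cong (λ x → step f c ℤ.+ x) (sumBy2-step n f (c ℤ.+ + 2)) ⟩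
  step f c ℤ.+ (sumBy2 n f (c ℤ.+ + 2 ℤ.- 1ℤ) ℤ.+ sumBy2 n f (c ℤ.+ + 2 ℤ.+ 1ℤ))
    ≡⟨ cong₂ (λ x y → step f c ℤ.+ (sumBy2 n f x ℤ.+ sumBy2 n f y)) (comm₋ c) (comm₊ c) ⟩
  step f c ℤ.+ (sumBy2 n f (c ℤ.- 1ℤ ℤ.+ + 2) ℤ.+ sumBy2 n f (c ℤ.+ 1ℤ ℤ.+ + 2))
    ≡⟨ interchange (f (c ℤ.- 1ℤ)) (f (c ℤ.+ 1ℤ)) _ _ ⟩
  sumBy2 (suc n) f (c ℤ.- 1ℤ) ℤ.+ sumBy2 (suc n) f (c ℤ.+ 1ℤ) ∎
  where
  open ≡-Reasoning
  comm₋ : ∀ c → c ℤ.+ + 2 ℤ.- 1ℤ ≡ c ℤ.- 1ℤ ℤ.+ + 2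
  comm₋ = ℤ-Solver.solve-∀
  comm₊ : ∀ c → c ℤ.+ + 2 ℤ.+ 1ℤ ≡ c ℤ.+ 1ℤ ℤ.+ + 2
  comm₊ = ℤ-Solver.solve-∀
  interchange : ∀ a b x y → (a ℤ.+ b) ℤ.+ (x ℤ.+ y) ≡ (a ℤ.+ x) ℤ.+ (b ℤ.+ y)
  interchange = ℤ-Solver.solve-∀

sumBy2-affine : ∀ a b f n c →
  sumBy2 n (λ x → a ℤ.* f x ℤ.- b) c ≡ a ℤ.* sumBy2 n f c ℤ.- + n ℤ.* b
sumBy2-affine a b f zero    c = base a b
  where
  base : ∀ a b → 0ℤ ≡ a ℤ.* 0ℤ ℤ.- 0ℤ ℤ.* b
  base = ℤ-Solver.solve-∀
sumBy2-affine a b f (suc n) c = trans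
  (cong (λ x → a ℤ.* f c ℤ.- b ℤ.+ x) (sumBy2-affine a b f n (c ℤ.+ + 2)))
  (regroup a b (f c) (sumBy2 n f (c ℤ.+ + 2)) (+ n))
  where
  regroup : ∀ a b x y n →
    a ℤ.* x ℤ.- b ℤ.+ (a ℤ.* y ℤ.- n ℤ.* b) ≡ a ℤ.* (x ℤ.+ y) ℤ.- (1ℤ ℤ.+ n) ℤ.* b
  regroup = ℤ-Solver.solve-∀

sumBy2-zero : ∀ n f c → (∀ j → j < n → f (c ℤ.+ + 2 ℤ.* + j) ≡ 0ℤ) → sumBy2 n f c ≡ 0ℤ
sumBy2-zero zero    f c f≡0 = refl
sumBy2-zero (suc n) f c f≡0 = cong₂ ℤ._+_
  (trans (cong f (head-point c)) (f≡0 0 ℕ.z<s))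
  (sumBy2-zero n f (c ℤ.+ + 2)
    (λ j j<n → trans (cong f (tail-point c (+ j))) (f≡0 (suc j) (s≤s j<n))))
  where
  head-point : ∀ c → c ≡ c ℤ.+ + 2 ℤ.* 0ℤ
  head-point = ℤ-Solver.solve-∀
  tail-point : ∀ c j → c ℤ.+ + 2 ℤ.+ + 2 ℤ.* j ≡ c ℤ.+ + 2 ℤ.* (1ℤ ℤ.+ j)
  tail-point = ℤ-Solver.solve-∀

sumBy2-snoc : ∀ n f c →
  sumBy2 n f c ℤ.+ f (c ℤ.+ + 2 ℤ.* + n) ≡ f c ℤ.+ sumBy2 n f (c ℤ.+ + 2)
sumBy2-snoc zero    f c = trans
  (ℤ.+-comm 0ℤ (f (c ℤ.+ + 2 ℤ.* 0ℤ))) (cong (λ x → f x ℤ.+ 0ℤ) (endpoint c))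
  where
  endpoint : ∀ c → c ℤ.+ + 2 ℤ.* 0ℤ ≡ c
  endpoint = ℤ-Solver.solve-∀
sumBy2-snoc (suc n) f c = begin
  f c ℤ.+ sumBy2 n f (c ℤ.+ + 2) ℤ.+ f (c ℤ.+ + 2 ℤ.* + suc n)
    ≡⟨ ℤ.+-assoc (f c) _ _ ⟩
  f c ℤ.+ (sumBy2 n f (c ℤ.+ + 2) ℤ.+ f (c ℤ.+ + 2 ℤ.* + suc n))
    ≡⟨ cong (λ x → f c ℤ.+ (sumBy2 n f (c ℤ.+ + 2) ℤ.+ f x)) (endpoint c (+ n)) ⟩
  f c ℤ.+ (sumBy2 n f (c ℤ.+ + 2) ℤ.+ f (c ℤ.+ + 2 ℤ.+ + 2 ℤ.* + n))
    ≡⟨ cong (λ x → f c ℤ.+ x) (sumBy2-snoc n f (c ℤ.+ + 2)) ⟩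
  f c ℤ.+ sumBy2 (suc n) f (c ℤ.+ + 2) ∎
  where
  open ≡-Reasoning
  endpoint : ∀ c n → c ℤ.+ + 2 ℤ.* (1ℤ ℤ.+ n) ≡ c ℤ.+ + 2 ℤ.+ + 2 ℤ.* n
  endpoint = ℤ-Solver.solve-∀

sumBy2-periodic : ∀ n f d → (∀ c → f (c ℤ.+ d) ≡ f c) →
  ∀ c → sumBy2 n f (c ℤ.+ d) ≡ sumBy2 n f c
sumBy2-periodic zero    f d periodic c = refl
sumBy2-periodic (suc n) f d periodic c = cong₂ ℤ._+_ (periodic c)
  (trans (cong (sumBy2 n f) (swap c d)) (sumBy2-periodic n f d periodic (c ℤ.+ + 2)))
  where
  swap : ∀ c d → c ℤ.+ d ℤ.+ + 2 ≡ c ℤ.+ + 2 ℤ.+ d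
  swap = ℤ-Solver.solve-∀

iterate-shift : ∀ (f : ℤ → ℤ) d → (∀ c → f (c ℤ.+ d) ≡ f c) →
  ∀ k c → f (c ℤ.+ d ℤ.* + k) ≡ f c
iterate-shift f d periodic zero    c = cong f (unit c d)
  where
  unit : ∀ c d → c ℤ.+ d ℤ.* 0ℤ ≡ c
  unit = ℤ-Solver.solve-∀
iterate-shift f d periodic (suc k) c = trans
  (cong f (split c d (+ k)))
  (trans (periodic _) (iterate-shift f d periodic k c))
  where
  split : ∀ c d k → c ℤ.+ d ℤ.* (1ℤ ℤ.+ k) ≡ c ℤ.+ d ℤ.* k ℤ.+ d
  split = ℤ-Solver.solve-∀

-- Growth of iterated steps and contraction of balanced functions.

Bounded : ℕ → (ℤ → ℤ) → Set
Bounded E f = ∀ c → ∣ f c ∣ ≤ E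

-- All starting points are included so that `step`, which moves the start by 1 either way, preserves
-- the property.
Balanced : ℕ → (ℤ → ℤ) → Set
Balanced n f = ∀ c → sumBy2 n f c ≡ 0ℤ

steps-balanced : ∀ n f → Balanced n f → ∀ m → Balanced n (steps m f)
steps-balanced n f balanced zero    c = balanced c
steps-balanced n f balanced (suc m) c = trans (sumBy2-step n (steps m f) c)
  (cong₂ ℤ._+_ (steps-balanced n f balanced m _) (steps-balanced n f balanced m _))

2^suc : ∀ m → 2 ^ suc m ≡ 2 ^ m + 2 ^ m
2^suc m = cong (λ x → 2 ^ m + x) (+-identityʳ (2 ^ m))

∣i+j∣≤m+n : ∀ i j {m n} → ∣ i ∣ ≤ m → ∣ j ∣ ≤ n → ∣ i ℤ.+ j ∣ ≤ m + n
∣i+j∣≤m+n i j i≤m j≤n = ≤-trans (ℤ.∣i+j∣≤∣i∣+∣j∣ i j) (+-mono-≤ i≤m j≤n)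

steps-bounded : ∀ {E f} → Bounded E f → ∀ m → Bounded (2 ^ m * E) (steps m f)
steps-bounded {E} bounded zero    c = ≤-trans (bounded c) (≤-reflexive (sym (*-identityˡ E)))
steps-bounded {E} {f} bounded (suc m) c = ≤-trans
  (∣i+j∣≤m+n (steps m f _) _ (steps-bounded bounded m _) (steps-bounded bounded m _))
  (≤-reflexive (sym (trans (cong (_* E) (2^suc m)) (*-distribʳ-+ E (2 ^ m) (2 ^ m)))))

-- This is 2^n - 1, defined by recursion to avoid truncated subtraction and to match the way the
-- error bounds add up.
mersenne : ℕ → ℕ
mersenne zero    = 0
mersenne (suc n) = mersenne n + 2 ^ n

suc-mersenne : ∀ n → suc (mersenne n) ≡ 2 ^ n
suc-mersenne zero    = refl
suc-mersenne (suc n) = trans (cong (_+ 2 ^ n) (suc-mersenne n)) (sym (2^suc n))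

mersenne≤2^ : ∀ n → mersenne n ≤ 2 ^ n
mersenne≤2^ n = ≤-trans (n≤1+n _) (≤-reflexive (suc-mersenne n))

-- Only the all-minus sign choice ends at c-L; each of the other 2^L - 1 choices contributes at most
-- `E`.
steps-leftmost : ∀ {E f} → Bounded E f → ∀ L c →
  ∣ steps L f c ℤ.- f (c ℤ.- + L) ∣ ≤ mersenne L * E
steps-leftmost {f = f} bounded zero    c =
  ≤-reflexive (cong ∣_∣ (trans (cong (λ x → f c ℤ.- f x) (ℤ.+-identityʳ c)) (ℤ.+-inverseʳ (f c))))
steps-leftmost {E} {f} bounded (suc L) c = begin
  ∣ steps L f (c ℤ.- 1ℤ) ℤ.+ steps L f (c ℤ.+ 1ℤ) ℤ.- f (c ℤ.- + suc L) ∣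
    ≡⟨ cong ∣_∣ (cong (λ x → steps L f (c ℤ.- 1ℤ) ℤ.+ steps L f (c ℤ.+ 1ℤ) ℤ.- f x) (point c (+ L))) ⟩
  ∣ steps L f (c ℤ.- 1ℤ) ℤ.+ steps L f (c ℤ.+ 1ℤ) ℤ.- f (c ℤ.- 1ℤ ℤ.- + L) ∣
    ≡⟨ cong ∣_∣ (regroup (steps L f (c ℤ.- 1ℤ)) (steps L f (c ℤ.+ 1ℤ)) _) ⟩
  ∣ steps L f (c ℤ.- 1ℤ) ℤ.- f (c ℤ.- 1ℤ ℤ.- + L) ℤ.+ steps L f (c ℤ.+ 1ℤ) ∣
    ≤⟨ ∣i+j∣≤m+n (steps L f (c ℤ.- 1ℤ) ℤ.- f (c ℤ.- 1ℤ ℤ.- + L)) _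
         (steps-leftmost bounded L _) (steps-bounded bounded L _) ⟩
  mersenne L * E + 2 ^ L * E
    ≡⟨ *-distribʳ-+ E (mersenne L) (2 ^ L) ⟨
  mersenne (suc L) * E ∎
  where
  open ≤-Reasoning
  point : ∀ c l → c ℤ.- (1ℤ ℤ.+ l) ≡ c ℤ.- 1ℤ ℤ.- l
  point = ℤ-Solver.solve-∀
  regroup : ∀ a b x → a ℤ.+ b ℤ.- x ≡ a ℤ.- x ℤ.+ b
  regroup = ℤ-Solver.solve-∀

-- steps L f c is a sum of f over 2^L sign choices whose endpoints are c−L, c−L+2, …, c+L;
-- subtracting each endpoint once leaves fewer than 2^L terms.
steps-endpoints : ∀ {E f} → Bounded E f → ∀ L c →
  ∣ steps L f c ℤ.- sumBy2 (suc L) f (c ℤ.- + L) ∣ ≤ mersenne L * E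
steps-endpoints {f = f} bounded zero    c =
  ≤-reflexive (cong ∣_∣ (trans (cong (λ x → f c ℤ.- (f x ℤ.+ 0ℤ)) (ℤ.+-identityʳ c)) (cancel (f c))))
  where
  cancel : ∀ a → a ℤ.- (a ℤ.+ 0ℤ) ≡ 0ℤ
  cancel = ℤ-Solver.solve-∀
steps-endpoints {E} {f} bounded (suc L) c = begin
  ∣ a ℤ.+ b ℤ.- (f (c ℤ.- + suc L) ℤ.+ sumBy2 (suc L) f (c ℤ.- + suc L ℤ.+ + 2)) ∣
    ≡⟨ cong ∣_∣ (cong₂ (λ x y → a ℤ.+ b ℤ.- (f x ℤ.+ sumBy2 (suc L) f y))
         (first c (+ L)) (second c (+ L))) ⟩
  ∣ a ℤ.+ b ℤ.- (f (c ℤ.- 1ℤ ℤ.- + L) ℤ.+ sumBy2 (suc L) f (c ℤ.+ 1ℤ ℤ.- + L)) ∣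
    ≡⟨ cong ∣_∣ (regroup a b (f (c ℤ.- 1ℤ ℤ.- + L)) (sumBy2 (suc L) f (c ℤ.+ 1ℤ ℤ.- + L))) ⟩
  -- A first step to the left supplies the leftmost endpoint; the other `suc L` endpoints are all
  -- supplied by a first step to the right.
  ∣ (a ℤ.- f (c ℤ.- 1ℤ ℤ.- + L)) ℤ.+ (b ℤ.- sumBy2 (suc L) f (c ℤ.+ 1ℤ ℤ.- + L)) ∣
    ≤⟨ ∣i+j∣≤m+n (a ℤ.- f (c ℤ.- 1ℤ ℤ.- + L)) _
         (steps-leftmost bounded L _) (steps-endpoints bounded L _) ⟩
  mersenne L * E + mersenne L * E
    ≤⟨ +-monoʳ-≤ (mersenne L * E) (*-monoˡ-≤ E (mersenne≤2^ L)) ⟩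
  mersenne L * E + 2 ^ L * E
    ≡⟨ *-distribʳ-+ E (mersenne L) (2 ^ L) ⟨
  mersenne (suc L) * E ∎
  where
  open ≤-Reasoning
  a = steps L f (c ℤ.- 1ℤ)
  b = steps L f (c ℤ.+ 1ℤ)
  first : ∀ c l → c ℤ.- (1ℤ ℤ.+ l) ≡ c ℤ.- 1ℤ ℤ.- l
  first = ℤ-Solver.solve-∀
  second : ∀ c l → c ℤ.- (1ℤ ℤ.+ l) ℤ.+ + 2 ≡ c ℤ.+ 1ℤ ℤ.- l
  second = ℤ-Solver.solve-∀
  regroup : ∀ a b x y → a ℤ.+ b ℤ.- (x ℤ.+ y) ≡ (a ℤ.- x) ℤ.+ (b ℤ.- y)
  regroup = ℤ-Solver.solve-∀

-- Balance makes the endpoint sum in `steps-endpoints` vanish, so the trivial factor 2^L improves to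
-- 2^L - 1.
steps-contracts : ∀ {E f} L → Balanced (suc L) f → Bounded E f →
  Bounded (mersenne L * E) (steps L f)
steps-contracts {E} {f} L balanced bounded c = subst (_≤ mersenne L * E)
  (cong ∣_∣ (trans (cong (λ x → steps L f c ℤ.- x) (balanced _)) (ℤ.+-identityʳ (steps L f c))))
  (steps-endpoints bounded L c)

steps-contracts-^ : ∀ {E f} L → Balanced (suc L) f → Bounded E f →
  ∀ k → Bounded (mersenne L ^ k * E) (steps (k * L) f)
steps-contracts-^ {E} L balanced bounded zero    c =
  ≤-trans (bounded c) (≤-reflexive (sym (*-identityˡ E)))
steps-contracts-^ {E} {f} L balanced bounded (suc k) =
  subst₂ Bounded (sym (*-assoc (mersenne L) (mersenne L ^ k) E)) (sym (steps-+ L (k * L) f))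
    (steps-contracts L (steps-balanced (suc L) f balanced (k * L))
      (steps-contracts-^ L balanced bounded k))

-- Decay of the error relative to 2^m.

-- The left side is the second term in the binomial expansion of the right side.
bernoulli : ∀ x k → suc k * x ^ k ≤ suc x ^ suc k
bernoulli x zero    = s≤s z≤n
bernoulli x (suc k) = begin
  suc (suc k) * x ^ suc k              ≡⟨ expand k x (x ^ k) ⟩
  x ^ suc k + x * (suc k * x ^ k)      ≤⟨ +-mono-≤ x^k≤ (*-monoʳ-≤ x (bernoulli x k)) ⟩
  suc x ^ suc k + x * suc x ^ suc k    ∎
  where
  open ≤-Reasoning
  expand : ∀ k x y → (2 + k) * (x * y) ≡ x * y + x * ((1 + k) * y)
  expand = solve-∀
  x^k≤ : x ^ suc k ≤ suc x ^ suc k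
  x^k≤ = ^-monoˡ-≤ (suc k) (n≤1+n x)

exponential-gap : ∀ B x → ∃[ k ] B * x ^ k ≤ suc x ^ k
-- With this exponent the factor from `bernoulli` exceeds B·x, where x is the one surplus power on
-- the left.
exponential-gap B x = suc (B * x) , (begin
  B * (x * x ^ (B * x))           ≡⟨ *-assoc B x _ ⟨
  B * x * x ^ (B * x)             ≤⟨ *-monoˡ-≤ (x ^ (B * x)) (n≤1+n (B * x)) ⟩
  suc (B * x) * x ^ (B * x)       ≤⟨ bernoulli x (B * x) ⟩
  suc x ^ suc (B * x)             ∎)
  where open ≤-Reasoning

-- After k blocks of L steps the bound is as small as desired against (2^L)^k. Each of the remaining
-- i steps at most doubles it, just as 2^m doubles.
steps-negligible : ∀ {E f} L → Balanced (suc L) f → Bounded E f →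
  ∀ B → ∃[ N ] ∀ m → N ≤ m → ∀ c → B * ∣ steps m f c ∣ ≤ 2 ^ m
steps-negligible {E} {f} L balanced bounded B
  with k , gap ← exponential-gap (B * E) (mersenne L) = k * L , λ m kL≤m c →
  let open ≤-Reasoning
      i = m ∸ k * L
      i+kL≡m = m∸n+n≡m kL≤m
  in begin
  B * ∣ steps m f c ∣
    ≡⟨ cong (λ x → B * ∣ steps x f c ∣) i+kL≡m ⟨
  B * ∣ steps (i + k * L) f c ∣
    ≡⟨ cong (λ g → B * ∣ g c ∣) (steps-+ i (k * L) f) ⟩
  B * ∣ steps i (steps (k * L) f) c ∣
    ≤⟨ *-monoʳ-≤ B (steps-bounded (steps-contracts-^ L balanced bounded k) i c) ⟩
  B * (2 ^ i * (mersenne L ^ k * E))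
    ≡⟨ regroup B (2 ^ i) (mersenne L ^ k) E ⟩
  2 ^ i * (B * E * mersenne L ^ k)
    ≤⟨ *-monoʳ-≤ (2 ^ i) gap ⟩
  2 ^ i * suc (mersenne L) ^ k
    ≡⟨ cong (λ x → 2 ^ i * x ^ k) (suc-mersenne L) ⟩
  2 ^ i * (2 ^ L) ^ k
    ≡⟨ cong (2 ^ i *_) (trans (^-*-assoc 2 L k) (cong (2 ^_) (*-comm L k))) ⟩
  2 ^ i * 2 ^ (k * L)
    ≡⟨ ^-distribˡ-+-* 2 i (k * L) ⟨
  2 ^ (i + k * L)
    ≡⟨ cong (2 ^_) i+kL≡m ⟩
  2 ^ m ∎
  where
  regroup : ∀ b t x e → b * (t * (x * e)) ≡ t * (b * e * x)
  regroup = solve-∀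

-- Counting relators of fixed length by residue class.

module _ {A B : Set} {P : Pred B 0ℓ} {Q : Pred A 0ℓ} (P? : Decidable P) (Q? : Decidable Q)
         (f : A → B) (agree : ∀ x → does (P? (f x)) ≡ does (Q? x)) where

  length-filter-map : ∀ xs → length (filter P? (map f xs)) ≡ length (filter Q? xs)
  length-filter-map []       = refl
  length-filter-map (x ∷ xs) rewrite agree x with does (Q? x)
  ... | true  = cong suc (length-filter-map xs)
  ... | false = length-filter-map xs

relatorsOfLength-suc : ∀ m → relatorsOfLength (suc m) ≡
  map (Sign.+ ∷_) (relatorsOfLength m) ++ map (Sign.- ∷_) (relatorsOfLength m)
relatorsOfLength-suc m =
  -- The cartesian product unfolds with a trailing `++ []`, which is removed here.
  cong (map (Sign.+ ∷_) (relatorsOfLength m) ++_) (++-identityʳ (map (Sign.- ∷_) (relatorsOfLength m)))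

module _ (q : ℕ) where

  -- The offset `c` carries the letters already split off, so that the recursion on the first letter
  -- closes.
  hits? : ∀ c → Decidable (λ w → + q ∣ X w ℤ.+ c)
  hits? c w = q ∣? ∣ X w ℤ.+ c ∣

  count : ℕ → ℤ → ℕ
  count m c = length (filter (hits? c) (relatorsOfLength m))

  count-suc : ∀ m c → count (suc m) c ≡ count m (c ℤ.- 1ℤ) + count m (c ℤ.+ 1ℤ)
  count-suc m c = begin
    count (suc m) c
      ≡⟨ cong (length ∘ filter (hits? c)) (relatorsOfLength-suc m) ⟩
    length (filter (hits? c) (map (Sign.+ ∷_) ws ++ map (Sign.- ∷_) ws))
      ≡⟨ cong length (filter-++ (hits? c) (map (Sign.+ ∷_) ws) _) ⟩
    length (filter (hits? c) (map (Sign.+ ∷_) ws) ++ filter (hits? c) (map (Sign.- ∷_) ws))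
      ≡⟨ length-++ (filter (hits? c) (map (Sign.+ ∷_) ws)) ⟩
    length (filter (hits? c) (map (Sign.+ ∷_) ws)) + length (filter (hits? c) (map (Sign.- ∷_) ws))
      ≡⟨ cong₂ _+_ plus minus ⟩
    count m (c ℤ.+ 1ℤ) + count m (c ℤ.- 1ℤ)
      ≡⟨ +-comm (count m (c ℤ.+ 1ℤ)) _ ⟩
    count m (c ℤ.- 1ℤ) + count m (c ℤ.+ 1ℤ) ∎
    where
    open ≡-Reasoning
    ws = relatorsOfLength m
    move₊ : ∀ x c → 1ℤ ℤ.+ x ℤ.+ c ≡ x ℤ.+ (c ℤ.+ 1ℤ)
    move₊ = ℤ-Solver.solve-∀
    move₋ : ∀ x c → ℤ.-1ℤ ℤ.+ x ℤ.+ c ≡ x ℤ.+ (c ℤ.- 1ℤ)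
    move₋ = ℤ-Solver.solve-∀
    plus : length (filter (hits? c) (map (Sign.+ ∷_) ws)) ≡ count m (c ℤ.+ 1ℤ)
    plus = length-filter-map (hits? c) (hits? (c ℤ.+ 1ℤ)) (Sign.+ ∷_)
      (λ w → cong (λ x → does (q ∣? ∣ x ∣)) (move₊ (X w) c)) ws
    minus : length (filter (hits? c) (map (Sign.- ∷_) ws)) ≡ count m (c ℤ.- 1ℤ)
    minus = length-filter-map (hits? c) (hits? (c ℤ.- 1ℤ)) (Sign.- ∷_)
      (λ w → cong (λ x → does (q ∣? ∣ x ∣)) (move₋ (X w) c)) ws

  -- The empty relator is the only one of length 0, so this is the characteristic function of the
  -- multiples of `q`.
  indicator : ℤ → ℤ
  indicator c = + count 0 c

  -- The deviation of the count from 2^m/q at m = 0, multiplied by `q` to stay in ℤ.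
  initialError : ℤ → ℤ
  initialError c = + q ℤ.* indicator c ℤ.- 1ℤ

  error : ℕ → ℤ → ℤ
  error m = steps m initialError

  error-count : ∀ m c → error m c ≡ + q ℤ.* + count m c ℤ.- + (2 ^ m)
  error-count zero    c = refl
  error-count (suc m) c = begin
    error m (c ℤ.- 1ℤ) ℤ.+ error m (c ℤ.+ 1ℤ)
      ≡⟨ cong₂ ℤ._+_ (error-count m _) (error-count m _) ⟩
    (+ q ℤ.* + a ℤ.- + (2 ^ m)) ℤ.+ (+ q ℤ.* + b ℤ.- + (2 ^ m))
      ≡⟨ regroup (+ q) (+ a) (+ b) (+ (2 ^ m)) ⟩
    + q ℤ.* + (a + b) ℤ.- + (2 ^ m + 2 ^ m)
      ≡⟨ cong₂ (λ x y → + q ℤ.* + x ℤ.- + y) (count-suc m c) (2^suc m) ⟨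
    + q ℤ.* + count (suc m) c ℤ.- + (2 ^ suc m) ∎
    where
    open ≡-Reasoning
    a = count m (c ℤ.- 1ℤ)
    b = count m (c ℤ.+ 1ℤ)
    regroup : ∀ q a b t →
      (q ℤ.* a ℤ.- t) ℤ.+ (q ℤ.* b ℤ.- t) ≡ q ℤ.* (a ℤ.+ b) ℤ.- (t ℤ.+ t)
    regroup = ℤ-Solver.solve-∀

  indicator-yes : ∀ c → + q ∣ c → indicator c ≡ 1ℤ
  indicator-yes c q∣c
    rewrite dec-true (hits? c []) (subst (+ q ∣_) (sym (ℤ.+-identityˡ c)) q∣c) = refl

  indicator-no : ∀ c → ¬ (+ q ∣ c) → indicator c ≡ 0ℤ
  indicator-no c q∤c
    rewrite dec-false (hits? c []) (q∤c ∘ subst (+ q ∣_) (ℤ.+-identityˡ c)) = refl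

  indicator-periodic : ∀ c → indicator (c ℤ.+ + q) ≡ indicator c
  indicator-periodic c with q ∣? ∣ c ∣
  ... | yes q∣c = trans
    (indicator-yes (c ℤ.+ + q)
      (Signed.∣⇒∣ᵤ (Signed.∣m∣n⇒∣m+n (Signed.∣ᵤ⇒∣ {+ q} {c} q∣c) Signed.∣-refl)))
    (sym (indicator-yes c q∣c))
  ... | no  q∤c = trans
    (indicator-no (c ℤ.+ + q) (λ q∣c+q →
      q∤c (Signed.∣⇒∣ᵤ (Signed.∣m+n∣n⇒∣m {m = c} (Signed.∣ᵤ⇒∣ q∣c+q) Signed.∣-refl))))
    (sym (indicator-no c q∤c))

  initialError-bounded : Bounded (q + 1) initialError
  initialError-bounded c = begin
    ∣ + q ℤ.* indicator c ℤ.- 1ℤ ∣    ≤⟨ ℤ.∣i-j∣≤∣i∣+∣j∣ (+ q ℤ.* indicator c) 1ℤ ⟩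
    ∣ + q ℤ.* indicator c ∣ + 1       ≡⟨ cong (_+ 1) (ℤ.abs-* (+ q) (indicator c)) ⟩
    q * count 0 c + 1                 ≤⟨ +-monoˡ-≤ 1 (*-monoʳ-≤ q (length-filter (hits? c) ([] ∷ []))) ⟩
    q * 1 + 1                         ≡⟨ cong (_+ 1) (*-identityʳ q) ⟩
    q + 1                             ∎
    where open ≤-Reasoning

  -- A shift by 2 drops the point c and gains c + 2q, where the `q`-periodic indicator has the same
  -- value.
  sumBy2-indicator-shift : ∀ i c →
    sumBy2 q indicator (c ℤ.+ + 2 ℤ.* + i) ≡ sumBy2 q indicator c
  sumBy2-indicator-shift = iterate-shift (sumBy2 q indicator) (+ 2) shift
    where
    open ≡-Reasoning
    open Group (AbelianGroup.group ℤ.+-0-abelianGroup) using (∙-cancelˡ)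
    shift : ∀ c → sumBy2 q indicator (c ℤ.+ + 2) ≡ sumBy2 q indicator c
    shift c = ∙-cancelˡ (indicator c) _ _ (begin
      indicator c ℤ.+ sumBy2 q indicator (c ℤ.+ + 2)
        ≡⟨ sumBy2-snoc q indicator c ⟨
      sumBy2 q indicator c ℤ.+ indicator (c ℤ.+ + 2 ℤ.* + q)
        ≡⟨ cong (λ x → sumBy2 q indicator c ℤ.+ indicator (c ℤ.+ x)) (ℤ.*-comm (+ 2) (+ q)) ⟩
      sumBy2 q indicator c ℤ.+ indicator (c ℤ.+ + q ℤ.* + 2)
        ≡⟨ cong (λ x → sumBy2 q indicator c ℤ.+ x) (iterate-shift indicator (+ q) indicator-periodic 2 c) ⟩
      sumBy2 q indicator c ℤ.+ indicator c
        ≡⟨ ℤ.+-comm (sumBy2 q indicator c) _ ⟩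
      indicator c ℤ.+ sumBy2 q indicator c ∎)

-- Odd moduli and the balance of the initial error.

Odd : ℕ → Set
Odd n = ∃[ r ] n ≡ suc (2 * r)

¬2∣⇒odd : ∀ n → ¬ (2 ℕ.∣ n) → Odd n
¬2∣⇒odd n 2∤n with n ℕ.% 2 in eq | ℕ.m%n<n n 2
... | 0           | _             = contradiction (ℕ.m%n≡0⇒n∣m n 2 eq) 2∤n
... | 1           | _             = n ℕ./ 2 ,
  trans (ℕ.m≡m%n+[m/n]*n n 2) (cong₂ _+_ eq (*-comm (n ℕ./ 2) 2))
... | suc (suc _) | s≤s (s≤s ())

odd-^ : ∀ {n} k → Odd n → Odd (n ^ k)
odd-^ zero    odd = 0 , refl
odd-^ (suc k) (r , refl) with t , eq ← odd-^ k (r , refl) =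
  r + t + 2 * (r * t) , trans (cong (suc (2 * r) *_) eq) (product r t)
  where
  product : ∀ r t → (1 + 2 * r) * (1 + 2 * t) ≡ 1 + 2 * (r + t + 2 * (r * t))
  product = solve-∀

-- With q = 2r + 1, both r·2k and r·2k + k = k·q are multiples of q, hence so is k.
odd-cancels-2 : ∀ r k → suc (2 * r) ℕ.∣ 2 * k → suc (2 * r) ℕ.∣ k
odd-cancels-2 r k q∣2k = ℕ.∣m+n∣m⇒∣n
  (ℕ.divides k (split r k))
  (ℕ.∣n⇒∣m*n r q∣2k)
  where
  split : ∀ r k → r * (2 * k) + k ≡ k * (1 + 2 * r)
  split = solve-∀

module _ (r : ℕ) where

  private
    q = suc (2 * r)

    +q≡ : + q ≡ 1ℤ ℤ.+ + 2 ℤ.* + r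
    +q≡ = cong (λ x → 1ℤ ℤ.+ x) (ℤ.pos-* 2 r)

  -- The inverse of 2 modulo q is r + 1, and that of -2 is r: n + 2rn = qn and -n + 2(r + 1)n = qn.
  -- Together with invariance under shifts by 2 and by q, this moves every window of
  -- `sumBy2-indicator` to start at 0.
  even-shift-to-multiple : ∀ c → ∃[ i ] ∃[ k ] c ℤ.+ + 2 ℤ.* + i ≡ 0ℤ ℤ.+ + q ℤ.* + k
  even-shift-to-multiple (+ n) = r * n , n ,
    trans (cong (λ x → + n ℤ.+ + 2 ℤ.* x) (ℤ.pos-* r n))
      (trans (solution (+ n) (+ r)) (cong (λ x → 0ℤ ℤ.+ x ℤ.* + n) (sym +q≡)))
    where
    solution : ∀ n r → n ℤ.+ + 2 ℤ.* (r ℤ.* n) ≡ 0ℤ ℤ.+ (1ℤ ℤ.+ + 2 ℤ.* r) ℤ.* n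
    solution = ℤ-Solver.solve-∀
  even-shift-to-multiple -[1+ n ] = suc r * suc n , suc n ,
    trans (cong (λ x → -[1+ n ] ℤ.+ + 2 ℤ.* x) (ℤ.pos-* (suc r) (suc n)))
      (trans (solution (+ suc n) (+ r)) (cong (λ x → 0ℤ ℤ.+ x ℤ.* + suc n) (sym +q≡)))
    where
    solution : ∀ n r →
      ℤ.- n ℤ.+ + 2 ℤ.* ((1ℤ ℤ.+ r) ℤ.* n) ≡ 0ℤ ℤ.+ (1ℤ ℤ.+ + 2 ℤ.* r) ℤ.* n
    solution = ℤ-Solver.solve-∀

  -- Among 0, 2, ..., 4r only 0 is a multiple of q: if q divides 2(j + 1), it divides j + 1, which
  -- is positive and at most 2r.
  sumBy2-indicator-0 : sumBy2 q (indicator q) 0ℤ ≡ 1ℤ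
  sumBy2-indicator-0 = cong₂ ℤ._+_ (indicator-yes q 0ℤ (q ℕ.∣0))
    (sumBy2-zero (2 * r) (indicator q) (+ 2) λ j j<2r →
      indicator-no q (+ 2 ℤ.+ + 2 ℤ.* + j) λ q∣ →
      <⇒≱ (s≤s j<2r) (ℕ.∣⇒≤ (odd-cancels-2 r (suc j)
        (subst (λ x → q ℕ.∣ ∣ x ∣) (double j) q∣))))
    where
    factor : ∀ j → + 2 ℤ.+ + 2 ℤ.* j ≡ + 2 ℤ.* (1ℤ ℤ.+ j)
    factor = ℤ-Solver.solve-∀
    double : ∀ j → + 2 ℤ.+ + 2 ℤ.* + j ≡ + (2 * suc j)
    double j = trans (factor (+ j)) (sym (ℤ.pos-* 2 (suc j)))

  sumBy2-indicator : ∀ c → sumBy2 q (indicator q) c ≡ 1ℤ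
  sumBy2-indicator c with i , k , eq ← even-shift-to-multiple c = begin
    sumBy2 q (indicator q) c                        ≡⟨ sumBy2-indicator-shift q i c ⟨
    sumBy2 q (indicator q) (c ℤ.+ + 2 ℤ.* + i)      ≡⟨ cong (sumBy2 q (indicator q)) eq ⟩
    sumBy2 q (indicator q) (0ℤ ℤ.+ + q ℤ.* + k)     ≡⟨ iterate-shift (sumBy2 q (indicator q)) (+ q)
                                                         (sumBy2-periodic q (indicator q) (+ q) (indicator-periodic q)) k 0ℤ ⟩
    sumBy2 q (indicator q) 0ℤ                       ≡⟨ sumBy2-indicator-0 ⟩
    1ℤ                                              ∎
    where open ≡-Reasoning

  initialError-balanced : Balanced q (initialError q)
  initialError-balanced c = begin
    sumBy2 q (initialError q) c                         ≡⟨ sumBy2-affine (+ q) 1ℤ (indicator q) q c ⟩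
    + q ℤ.* sumBy2 q (indicator q) c ℤ.- + q ℤ.* 1ℤ     ≡⟨ cong (λ x → + q ℤ.* x ℤ.- + q ℤ.* 1ℤ) (sumBy2-indicator c) ⟩
    + q ℤ.* 1ℤ ℤ.- + q ℤ.* 1ℤ                           ≡⟨ ℤ.+-inverseʳ (+ q ℤ.* 1ℤ) ⟩
    0ℤ                                                  ∎
    where open ≡-Reasoning

error-negligible : ∀ q → Odd q →
  ∀ B → ∃[ N ] ∀ m → N ≤ m → ∀ c → B * ∣ error q m c ∣ ≤ 2 ^ m
error-negligible q (r , refl) =
  -- For L = 2r the window length `suc L` is exactly q.
  steps-negligible (2 * r) (initialError-balanced r) (initialError-bounded q)

-- From exact length to length at most s.

-- Stolz–Cesàro for limit 0, with Δ G / Δ p → 0 and G / p → 0 both cleared of denominators.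
module _ (G : ℕ → ℤ) (p : ℕ → ℕ) (unbounded : ∀ s → s < p s)
         (increments : ∀ B → ∃[ N ] ∀ m → N ≤ m → B * ∣ G (suc m) ℤ.- G m ∣ + p m ≤ p (suc m)) where

  -- Telescoping from `N`: the growth of `p` pays for every increment, and only the initial value of
  -- `G` remains.
  increments-accumulate : ∀ B N → (∀ m → N ≤ m → B * ∣ G (suc m) ℤ.- G m ∣ + p m ≤ p (suc m)) →
    ∀ t → B * ∣ G (t + N) ∣ ≤ B * ∣ G N ∣ + p (t + N)
  increments-accumulate B N small zero    = m≤m+n (B * ∣ G N ∣) (p N)
  increments-accumulate B N small (suc t) = begin
    B * ∣ G (suc m) ∣
      ≡⟨ cong (λ x → B * ∣ x ∣) (telescope (G (suc m)) (G m)) ⟩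
    B * ∣ (G (suc m) ℤ.- G m) ℤ.+ G m ∣
      ≤⟨ *-monoʳ-≤ B (ℤ.∣i+j∣≤∣i∣+∣j∣ (G (suc m) ℤ.- G m) (G m)) ⟩
    B * (∣ G (suc m) ℤ.- G m ∣ + ∣ G m ∣)
      ≡⟨ *-distribˡ-+ B ∣ G (suc m) ℤ.- G m ∣ ∣ G m ∣ ⟩
    B * ∣ G (suc m) ℤ.- G m ∣ + B * ∣ G m ∣
      ≤⟨ +-monoʳ-≤ (B * ∣ G (suc m) ℤ.- G m ∣) (increments-accumulate B N small t) ⟩
    B * ∣ G (suc m) ℤ.- G m ∣ + (B * ∣ G N ∣ + p m)
      ≡⟨ regroup (B * ∣ G (suc m) ℤ.- G m ∣) (B * ∣ G N ∣) (p m) ⟩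
    B * ∣ G N ∣ + (B * ∣ G (suc m) ℤ.- G m ∣ + p m)
      ≤⟨ +-monoʳ-≤ (B * ∣ G N ∣) (small m (m≤n+m N t)) ⟩
    B * ∣ G N ∣ + p (suc m) ∎
    where
    open ≤-Reasoning
    m = t + N
    telescope : ∀ x y → x ≡ (x ℤ.- y) ℤ.+ y
    telescope = ℤ-Solver.solve-∀
    regroup : ∀ x y z → x + (y + z) ≡ y + (x + z)
    regroup = solve-∀

  stolz-cesàro : ∀ B → ∃[ N ] ∀ s → N ≤ s → B * ∣ G s ∣ < p s
  -- Doubling `B` leaves room for two terms of size `p s`: one for the increments, one for the
  -- initial term 2B·∣G N∣. The threshold puts the latter at most s, which is below `p s`.
  stolz-cesàro B with N , small ← increments (2 * B) = N + 2 * B * ∣ G N ∣ , λ s N′≤s →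
    let open ≤-Reasoning
        N≤s = ≤-trans (m≤m+n N _) N′≤s
        s≡  = m∸n+n≡m N≤s
    in *-cancelˡ-< 2 _ _ (begin-strict
    2 * (B * ∣ G s ∣)
      ≡⟨ *-assoc 2 B ∣ G s ∣ ⟨
    2 * B * ∣ G s ∣
      ≤⟨ subst (λ x → 2 * B * ∣ G x ∣ ≤ 2 * B * ∣ G N ∣ + p x) s≡
           (increments-accumulate (2 * B) N small (s ∸ N)) ⟩
    2 * B * ∣ G N ∣ + p s
      <⟨ +-monoˡ-< (p s) (≤-<-trans (≤-trans (m≤n+m _ N) N′≤s) (unbounded s)) ⟩
    p s + p s
      ≡⟨ cong (λ x → p s + x) (+-identityʳ (p s)) ⟨
    2 * p s ∎)

length-relatorsOfLength : ∀ m → length (relatorsOfLength m) ≡ 2 ^ m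
length-relatorsOfLength zero    = refl
length-relatorsOfLength (suc m) = begin
  length (relatorsOfLength (suc m))
    ≡⟨ cong length (relatorsOfLength-suc m) ⟩
  length (map (Sign.+ ∷_) ws ++ map (Sign.- ∷_) ws)
    ≡⟨ length-++ (map (Sign.+ ∷_) ws) ⟩
  length (map (Sign.+ ∷_) ws) + length (map (Sign.- ∷_) ws)
    ≡⟨ cong₂ _+_ (length-map (Sign.+ ∷_) ws) (length-map (Sign.- ∷_) ws) ⟩
  length ws + length ws
    ≡⟨ cong (λ n → n + n) (length-relatorsOfLength m) ⟩
  2 ^ m + 2 ^ m
    ≡⟨ 2^suc m ⟨
  2 ^ suc m ∎
  where
  open ≡-Reasoning
  ws = relatorsOfLength m

P-suc : ∀ s → P (suc s) ≡ P s + 2 ^ suc s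
P-suc s = trans (length-++ (relatorsUpTo s)) (cong (λ n → P s + n) (length-relatorsOfLength (suc s)))

s<P : ∀ s → s < P s
s<P zero    = s≤s z≤n
s<P (suc s) = begin-strict
  suc s              ≤⟨ s<P s ⟩
  P s                ≡⟨ +-identityʳ (P s) ⟨
  P s + 0            <⟨ +-monoʳ-< (P s) (m^n>0 2 (suc s)) ⟩
  P s + 2 ^ suc s    ≡⟨ P-suc s ⟨
  P (suc s)          ∎
  where open ≤-Reasoning

P[]-suc : ∀ {Q : Pred Relator 0ℓ} (Q? : Decidable Q) s →
  P[ Q? ] (suc s) ≡ P[ Q? ] s + length (filter Q? (relatorsOfLength (suc s)))
P[]-suc Q? s = trans (cong length (filter-++ Q? (relatorsUpTo s) _))
  (length-++ (filter Q? (relatorsUpTo s)))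

module _ (q : ℕ) (odd : Odd q) where

  private
    Q? : Decidable (λ w → + q ∣ X w)
    Q? w = q ∣? ∣ X w ∣

  length-filter-count : ∀ m → length (filter Q? (relatorsOfLength m)) ≡ count q m 0ℤ
  length-filter-count m = trans
    -- Viewing the list as its image under `id` allows two different filters to be compared on it.
    (cong (length ∘ filter Q?) (sym (map-id (relatorsOfLength m))))
    (length-filter-map Q? (hits? q 0ℤ) id
      (λ w → cong (λ x → does (q ∣? ∣ x ∣)) (sym (ℤ.+-identityʳ (X w)))) (relatorsOfLength m))

  -- This is q · P s times the deviation of the density from 1/q.
  totalError : ℕ → ℤ
  totalError s = + P[ Q? ] s ℤ.* + q ℤ.- + P s

  totalError-increment : ∀ s → totalError (suc s) ℤ.- totalError s ≡ error q (suc s) 0ℤ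
  totalError-increment s = begin
    + P[ Q? ] (suc s) ℤ.* + q ℤ.- + P (suc s) ℤ.- totalError s
      ≡⟨ cong₂ (λ x y → + x ℤ.* + q ℤ.- + y ℤ.- totalError s)
           (trans (P[]-suc Q? s) (cong (λ n → P[ Q? ] s + n) (length-filter-count (suc s)))) (P-suc s) ⟩
    + (P[ Q? ] s + count q (suc s) 0ℤ) ℤ.* + q ℤ.- + (P s + 2 ^ suc s) ℤ.- totalError s
      ≡⟨ difference (+ P[ Q? ] s) (+ count q (suc s) 0ℤ) (+ q) (+ P s) (+ (2 ^ suc s)) ⟩
    + q ℤ.* + count q (suc s) 0ℤ ℤ.- + (2 ^ suc s)
      ≡⟨ error-count q (suc s) 0ℤ ⟨
    error q (suc s) 0ℤ ∎
    where
    open ≡-Reasoning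
    difference : ∀ a n q p t →
      (a ℤ.+ n) ℤ.* q ℤ.- (p ℤ.+ t) ℤ.- (a ℤ.* q ℤ.- p) ≡ q ℤ.* n ℤ.- t
    difference = ℤ-Solver.solve-∀

  totalError-negligible : ∀ B → ∃[ N ] ∀ s → N ≤ s → B * ∣ totalError s ∣ < P s
  totalError-negligible = stolz-cesàro totalError P s<P λ B →
    let open ≤-Reasoning
        N , small = error-negligible q odd B
    in N , λ m N≤m → begin
    B * ∣ totalError (suc m) ℤ.- totalError m ∣ + P m
      ≡⟨ cong (λ x → B * ∣ x ∣ + P m) (totalError-increment m) ⟩
    B * ∣ error q (suc m) 0ℤ ∣ + P m
      ≤⟨ +-monoˡ-≤ (P m) (small (suc m) (m≤n⇒m≤1+n N≤m) 0ℤ) ⟩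
    2 ^ suc m + P m
      ≡⟨ trans (+-comm (2 ^ suc m) (P m)) (sym (P-suc m)) ⟩
    P (suc m) ∎

-- Rational densities and the limit.

-- The difference of the fractions has absolute value ∣aq - b∣/(bq), and a positive `ε` is at least
-- 1/`↧ₙ ε` because its numerator is at least 1.
quotient-close : ∀ a b q .{{_ : NonZero b}} .{{_ : NonZero q}} ε → 0ℚ ℚ.< ε →
  ↧ₙ ε * ∣ + a ℤ.* + q ℤ.- + b ∣ < b → ℚ.∣ + a / b ℚ.- + 1 / q ∣ ℚ.< ε
quotient-close a b q (mkℚ (+ 0) _ _) (ℚ.*<* (+<+ ())) _
quotient-close a b q (mkℚ -[1+ _ ] _ _) (ℚ.*<* ()) _
quotient-close a b@(suc b-1) q@(suc q-1) ε@(mkℚ +[1+ e ] d-1 _) _ small =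
  -- Unnormalised fractions are not reduced, so there the inequality is plain cross-multiplication.
  ℚ.toℚᵘ-cancel-< (ℚᵘ.<-respˡ-≃ (ℚᵘ.≃-sym toℚᵘ-difference) (ℚᵘ.*<* cleared))
  where
  u v : ℚᵘ.ℚᵘ
  u = mkℚᵘ (+ a) b-1
  v = mkℚᵘ (+ 1) q-1
  toℚᵘ-difference : toℚᵘ (ℚ.∣ + a / b ℚ.- + 1 / q ∣) ℚᵘ.≃ ℚᵘ.∣ u ℚᵘ.- v ∣
  toℚᵘ-difference = ℚᵘ.≃-trans (ℚ.toℚᵘ-homo-∣-∣ (+ a / b ℚ.- + 1 / q)) (ℚᵘ.∣-∣-cong
    (ℚᵘ.≃-trans (ℚ.toℚᵘ-homo-+ (+ a / b) (ℚ.- (+ 1 / q))) (ℚᵘ.+-cong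
      (ℚ.toℚᵘ-fromℚᵘ u)
      (ℚᵘ.≃-trans (ℚ.toℚᵘ-homo‿- (+ 1 / q)) (ℚᵘ.-‿cong (ℚ.toℚᵘ-fromℚᵘ v))))))
  -- The numerator in the form in which unnormalised subtraction computes it.
  D = ∣ + a ℤ.* + q ℤ.+ (ℤ.- + 1) ℤ.* + b ∣
  D≡ : D ≡ ∣ + a ℤ.* + q ℤ.- + b ∣
  D≡ = cong (λ x → ∣ + a ℤ.* + q ℤ.+ x ∣) (ℤ.-1*i≡-i (+ b))
  cleared-ℕ : D * suc d-1 < suc e * (b * q)
  cleared-ℕ = begin-strict
    D * suc d-1                               ≡⟨ *-comm D (suc d-1) ⟩
    suc d-1 * D                               ≡⟨ cong (suc d-1 *_) D≡ ⟩
    suc d-1 * ∣ + a ℤ.* + q ℤ.- + b ∣         <⟨ small ⟩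
    b                                         ≤⟨ m≤m*n b q ⟩
    b * q                                     ≤⟨ m≤n*m (b * q) (suc e) ⟩
    suc e * (b * q)                           ∎
    where open ≤-Reasoning
  cleared : + D ℤ.* + suc d-1 ℤ.< + suc e ℤ.* + (b * q)
  cleared = subst₂ ℤ._<_ (ℤ.pos-* D (suc d-1)) (ℤ.pos-* (suc e) (b * q)) (+<+ cleared-ℕ)

lemma3p32 : (p : ℕ) (pp : Prime p) → ¬ (2 ℕ.∣ p) → (n : ℕ) →
    HasLimitingDensity
    (λ w → (+ (p ^ (n ℕ.+ 1))) ∣ X w)
    (λ w → (p ^ (n ℕ.+ 1)) ∣? ∣ X w ∣)
    ((+ 1 / (p ^ (n ℕ.+ 1))) {{m^n≢0 p (n ℕ.+ 1) {{prime⇒nonZero pp}}}})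
lemma3p32 p pp 2∤p n ε 0<ε
  -- The denominator of `ε` serves as the constant B, as `quotient-close` requires.
  with N , small ← totalError-negligible (p ^ (n + 1)) (odd-^ (n + 1) (¬2∣⇒odd p 2∤p)) (↧ₙ ε) =
  N , λ s N≤s → quotient-close (P[ (λ w → (p ^ (n + 1)) ∣? ∣ X w ∣) ] s) (P s) (p ^ (n + 1))
    {{P-nonZero s}} {{m^n≢0 p (n + 1) {{prime⇒nonZero pp}}}} ε 0<ε (small s N≤s)
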